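{- Let $k\ge2$. For every instance of the MUHV problem with $k$ colors, the linear programming relaxation (LP-MUHV) is the same as the Lovász-extension relaxation (CP-Sub-ML) of the associated Sub-ML instance with set function $f(X)=w(\partial(X))$. That is, the two programs have the same feasible assignments $(y_j^i)_{v_j\in V,\,i\in C}$, and for every such assignment the minimum of $\sum_{j=1}^n w_jx_j$ over all $(x_j^i),(x_j)$ which together with $(y_j^i)$ are feasible for (LP-MUHV) equals $$\sum_{i=1}^k\hat f(\mathbf{y}_i),\qquad \mathbf{y}_i=(y_1^i,\dots,y_n^i).$$
   Context: **MUHV instance.** A finite undirected graph $G=(V,E)$, $V=\{v_1,\dots,v_n\}$, non-negative vertex weights $w_j=w(v_j)$, a color set $C=\{1,\dots,k\}$, and a partial vertex coloring $c$ with colors in $C$ in which every color is used on at least one vertex. The goal in the MUHV problem is to extend $c$ to all vertices minimizing the total weight of unhappy vertices (vertices whose color differs from that of at least one neighbor). **(LP-MUHV).** Minimize $\sum_{j=1}^n w_jx_j$ subject to: $\sum_{i=1}^k y_j^i=1$ for all $v_j\in V$; $y_j^i=1$ whenever $c(v_j)=i$; $x_j^i\ge y_j^i-y_h^i$ for all $v_j\in V$, $v_h\in N(v_j)$, $i\in C$; $x_j=\sum_{i=1}^k x_j^i$ for all $v_j\in V$; and $y_j^i,x_j^i,x_j\ge0$. Here $N(v_j)$ is the set of neighbors of $v_j$. **Set function.** For $X\subseteq V$, $\partial(X)$ is the set of vertices of $X$ with at least one neighbor outside $X$, $w(X)=\sum_{v\in X}w(v)$, $f(X)=w(\partial(X))$.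 **Lovász extension.** For $\mathbf{y}\in[0,1]^V$ with maximum coordinate $1$ and minimum coordinate $0$, let $\pi$ be a permutation with $1=y_{\pi_1}\ge\dots\ge y_{\pi_n}=0$ and set $\hat f(\mathbf{y})=\sum_{j=1}^{n-1}(y_{\pi_j}-y_{\pi_{j+1}})\,f(\{v_{\pi_1},\dots,v_{\pi_j}\})$. **(CP-Sub-ML)** for this instance. Minimize $\sum_{i=1}^k\hat f(\mathbf{y}_i)$ subject to $\sum_{i=1}^k y_j^i=1$ for all $v_j\in V$; $y_j^i=1$ whenever $c(v_j)=i$; $y_j^i\ge0$ for all $v_j\in V$, $i\in C$. -}

module Defs where

open import Level using (0ℓ; _⊔_) renaming (suc to lsuc)
open import Algebra.Bundles using (CommutativeRing)
import Algebra.Definitions.RawMonoid as RawMonoidSum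
open import Data.Bool using (if_then_else_)
open import Data.Fin using (Fin; zero; suc; toℕ; inject₁)
import Data.Fin as Fin
open import Data.Fin.Permutation using (Permutation′; _⟨$⟩ʳ_; _⟨$⟩ˡ_)
open import Data.Fin.Properties using (any?)
open import Data.Fin.Subset using (Subset; _∉_)
open import Data.Fin.Subset.Properties using (_∈?_)
open import Data.Maybe using (Maybe; just)
open import Data.Nat as ℕ using (ℕ)
open import Data.Product using (∃; _×_)
open import Data.Vec using (tabulate; lookup)
open import Data.Vec.Functional using (Vector)
open import Relation.Binary using (Rel; IsTotalOrder; Decidable; Symmetric)
open import Relation.Binary.PropositionalEquality using (_≡_)
open import Relation.Nullary using (¬_; does; ¬?; _×-dec_)

-- The scalars.  The standard library has no real numbers, so everything is
-- parametrised by an arbitrary (totally) ordered field; the classical real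
-- numbers are one instance.
record OrderedField c ℓ₁ ℓ₂ : Set (lsuc (c ⊔ ℓ₁ ⊔ ℓ₂)) where
  field
    commutativeRing : CommutativeRing c ℓ₁
  open CommutativeRing commutativeRing public
  infix 4 _≤_
  field
    _≤_          : Rel Carrier ℓ₂
    isTotalOrder : IsTotalOrder _≈_ _≤_
    +-mono-≤     : ∀ {x y} z → x ≤ y → x + z ≤ y + z
    *-nonNeg     : ∀ {x y} → 0# ≤ x → 0# ≤ y → 0# ≤ x * y
    0≉1          : ¬ (0# ≈ 1#)
    inverse      : ∀ x → ¬ (x ≈ 0#) → ∃ λ x⁻¹ → x * x⁻¹ ≈ 1#

  open RawMonoidSum +-rawMonoid public using (sum)

-- Only neighbourhoods matter below, so adjacency is any symmetric relation:
-- loops are permitted but not required.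
record Graph (n : ℕ) : Set₁ where
  field
    Adj  : Rel (Fin n) 0ℓ
    adj? : Decidable Adj
    sym  : Symmetric Adj

  ∂ : Subset n → Subset n
  ∂ X = tabulate λ v →
    does ((v ∈? X) ×-dec any? (λ u → adj? v u ×-dec ¬? (u ∈? X)))

module _ {c ℓ₁ ℓ₂} (K : OrderedField c ℓ₁ ℓ₂) where
  open OrderedField K

  record MUHV (n k : ℕ) : Set (lsuc 0ℓ ⊔ c ⊔ ℓ₂) where
    field
      graph     : Graph n
      weight    : Vector Carrier n
      weight≥0  : ∀ v → 0# ≤ weight v
      -- nothing marks an uncoloured vertex.
      colour    : Fin n → Maybe (Fin k)
      allUsed   : ∀ i → ∃ λ v → colour v ≡ just i
    open Graph graph public

  -- y v i stands for y_v^i.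
  Assignment : ℕ → ℕ → Set c
  Assignment n k = Fin n → Fin k → Carrier

  -- m is the least value, and it is attained, of obj on the set S.
  IsMinimum : ∀ {a p} {A : Set a} → (A → Set p) → (A → Carrier) → Carrier →
              Set (a ⊔ p ⊔ ℓ₁ ⊔ ℓ₂)
  IsMinimum S obj m = (∃ λ a → S a × obj a ≈ m) × (∀ a → S a → m ≤ obj a)

  -- A permutation π with 1 = y_{π₁} ≥ … ≥ y_{πₙ} = 0; position p carries the
  -- element π ⟨$⟩ʳ p.
  record DecreasingOrder {n : ℕ} (y : Vector Carrier n) : Set (ℓ₁ ⊔ ℓ₂) where
    field
      π          : Permutation′ n
      decreasing : ∀ p q → p Fin.≤ q → y (π ⟨$⟩ʳ q) ≤ y (π ⟨$⟩ʳ p)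
      first≈1    : ∀ p → toℕ p ≡ 0 → y (π ⟨$⟩ʳ p) ≈ 1#
      last≈0     : ∀ p → ℕ.suc (toℕ p) ≡ n → y (π ⟨$⟩ʳ p) ≈ 0#

  -- The elements at positions 0, …, p.
  prefix : ∀ {n} → Permutation′ n → Fin n → Subset n
  prefix π p = tabulate λ v → does ((π ⟨$⟩ˡ v) Fin.≤? p)

  lovászSum : ∀ {n} → (Subset n → Carrier) → Vector Carrier n →
              Permutation′ n → Carrier
  lovászSum {ℕ.zero}  f y π = 0#
  lovászSum {ℕ.suc m} f y π = sum λ (p : Fin m) →
    (y (π ⟨$⟩ʳ inject₁ p) - y (π ⟨$⟩ʳ suc p)) * f (prefix π (inject₁ p))

  -- The Lovász extension at y, computed along a given decreasing order of y.
  lovász : ∀ {n} → (Subset n → Carrier) → (y : Vector Carrier n) →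
           DecreasingOrder y → Carrier
  lovász f y o = lovászSum f y (DecreasingOrder.π o)

  module _ {n k : ℕ} (I : MUHV n k) where
    open MUHV I

    w : Subset n → Carrier
    w X = sum λ v → if lookup X v then weight v else 0#

    boundaryWeight : Subset n → Carrier
    boundaryWeight X = w (∂ X)

    -- xc v i stands for x_v^i, and x v for x_v.
    record LP-Feasible (y xc : Assignment n k) (x : Vector Carrier n)
           : Set (ℓ₁ ⊔ ℓ₂) where
      field
        sum≈1      : ∀ v → sum (y v) ≈ 1#
        precolour  : ∀ v i → colour v ≡ just i → y v i ≈ 1#
        difference : ∀ v u → Adj v u → ∀ i → y v i - y u i ≤ xc v i
        total      : ∀ v → x v ≈ sum (xc v)
        y≥0        : ∀ v i → 0# ≤ y v i
        xc≥0       : ∀ v i → 0# ≤ xc v i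
        x≥0        : ∀ v → 0# ≤ x v

    LP-objective : Vector Carrier n → Carrier
    LP-objective x = sum λ v → weight v * x v

    record CP-Feasible (y : Assignment n k) : Set (ℓ₁ ⊔ ℓ₂) where
      field
        sum≈1     : ∀ v → sum (y v) ≈ 1#
        precolour : ∀ v i → colour v ≡ just i → y v i ≈ 1#
        y≥0       : ∀ v i → 0# ≤ y v i

    CP-objective : (y : Assignment n k) →
                   (∀ i → DecreasingOrder (λ v → y v i)) → Carrier
    CP-objective y o = sum λ i → lovász boundaryWeight (λ v → y v i) (o i)

{-# OPTIONS --safe #-}
-- For a decreasing order a₀ ≥ a₁ ≥ … of yⁱ, exchanging sums turns f̂(yⁱ) into
-- Σ_v w_v T_v, where T_v adds up the steps a_p − a_{p+1} over those p for which
-- v lies on the boundary of the p-th prefix.  These p run from the position of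
-- v up to just before the last position of a neighbour of v, so T_v is the
-- least non-negative number that is at least y_v − y_u for all neighbours u:
-- it is the optimal x_v^i.
module Submission where

open import Defs
open import Data.Nat using (ℕ; _≤_)
open import Data.Product using (_×_; ∃₂; proj₁; proj₂)
open import Function.Bundles using (_⇔_)

import Algebra.Properties.AbelianGroup as AbelianGroupProperties
import Algebra.Properties.Semiring.Sum as SemiringSum
open import Data.Bool using (Bool; true; false; if_then_else_)
open import Data.Fin using (Fin; zero; suc; toℕ; inject₁; punchIn)
import Data.Fin as Fin
open import Data.Fin.Permutation
  using (Permutation′; _⟨$⟩ʳ_; _⟨$⟩ˡ_; inverseʳ; insert; insert-punchIn)
  renaming (id to idₚ)
open import Data.Fin.Properties using (any?; toℕ<n; toℕ-inject₁)
open import Data.Fin.Subset using (Subset; _∈_; _∉_)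
open import Data.Fin.Subset.Properties using (_∈?_)
open import Data.List using (allFin)
import Data.List.Extrema as Extrema
import Data.List.Relation.Unary.All as All
open import Data.List.Membership.Propositional.Properties using (∈-allFin)
open import Data.Nat using (zero; suc; z≤n; s≤s)
import Data.Nat.Properties as ℕ
open import Data.Product using (∃; _,_)
open import Data.Vec using (tabulate; lookup)
open import Data.Vec.Functional using (Vector)
open import Data.Vec.Properties using (lookup∘tabulate; []=⇒lookup; lookup⇒[]=)
open import Function using (_∘_; mk⇔)
open import Level using (Level)
open import Relation.Binary using (TotalOrder)
import Relation.Binary.Reasoning.PartialOrder as PartialOrderReasoning
open import Relation.Binary.PropositionalEquality as ≡ using (_≡_)
open import Relation.Nullary using (yes; no; does; ¬?; _×-dec_; contradiction)
open import Relation.Nullary.Decidable using (dec-true)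
import Relation.Unary as Unary

private
  variable
    p : Level
    m n k : ℕ

-- Membership in decidable subsets and in boundaries.

module _ {P : Fin n → Set p} (P? : Unary.Decidable P) where

  ∈-tabulate⁺ : ∀ {v} → P v → v ∈ tabulate (does ∘ P?)
  ∈-tabulate⁺ {v} pv =
    lookup⇒[]= v _ (≡.trans (lookup∘tabulate _ v) (dec-true (P? v) pv))

  ∈-tabulate⁻ : ∀ {v} → v ∈ tabulate (does ∘ P?) → P v
  ∈-tabulate⁻ {v} v∈
    with P? v | ≡.trans (≡.sym (lookup∘tabulate (does ∘ P?) v)) ([]=⇒lookup v∈)
  ... | yes pv | _ = pv
  ... | no _   | ()

module _ (G : Graph n) where
  open Graph G

  ∈∂⁺ : ∀ {X : Subset n} {v u} → v ∈ X → Adj v u → u ∉ X → v ∈ ∂ X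
  ∈∂⁺ {X} v∈X adj u∉X = ∈-tabulate⁺
    (λ v → (v ∈? X) ×-dec any? (λ u → adj? v u ×-dec ¬? (u ∈? X)))
    (v∈X , _ , adj , u∉X)

  ∈∂⁻ : ∀ {X : Subset n} {v} → v ∈ ∂ X → v ∈ X × ∃ λ u → Adj v u × u ∉ X
  ∈∂⁻ {X} = ∈-tabulate⁻
    (λ v → (v ∈? X) ×-dec any? (λ u → adj? v u ×-dec ¬? (u ∈? X)))

-- Sorting a vector by a permutation.

module _ {a ℓ₁ ℓ₂} (O : TotalOrder a ℓ₁ ℓ₂) where
  open TotalOrder O renaming (_≤_ to _⊑_)

  maximumIndex : (y : Vector Carrier (suc m)) → ∃ λ i → ∀ j → y j ⊑ y i
  maximumIndex y =
    Extrema.argmax O y zero (allFin _) ,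
    λ j → All.lookup (Extrema.f[xs]≤f[argmax] O zero (allFin _)) (∈-allFin j)

  -- Selection sort: a maximal entry `i` takes position zero, and the entries other than `i`,
  -- enumerated by `punchIn i`, are sorted recursively.
  sortingPermutation : (y : Vector Carrier n) → ∃ λ (π : Permutation′ n) →
    ∀ p q → p Fin.≤ q → y (π ⟨$⟩ʳ q) ⊑ y (π ⟨$⟩ʳ p)
  sortingPermutation {zero}  y = idₚ , λ ()
  sortingPermutation {suc m} y with maximumIndex y
  ... | i , max with sortingPermutation (y ∘ punchIn i)
  ...   | π , decreasing = insert zero i π , decreasing′
    where
    decreasing′ : ∀ p q → p Fin.≤ q →
                  y (insert zero i π ⟨$⟩ʳ q) ⊑ y (insert zero i π ⟨$⟩ʳ p)
    decreasing′ zero    q       _         = max _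
    decreasing′ (suc p) (suc q) (s≤s p≤q)
      -- `punchIn zero p` computes to `suc p`, so the positions after the first carry `punchIn i` of
      -- what `π` puts there.
      rewrite insert-punchIn zero i π p | insert-punchIn zero i π q
      = decreasing p q p≤q

module _ {c ℓ₁ ℓ₂} (K : OrderedField c ℓ₁ ℓ₂) where
  open OrderedField K hiding (zero) renaming (_≤_ to _⊑_)
  open AbelianGroupProperties +-abelianGroup using (xyx⁻¹≈y)
  open SemiringSum semiring
    using (sum-cong-≋; sum-remove; ∑-comm; *-distribˡ-sum)

  totalOrder : TotalOrder c ℓ₁ ℓ₂
  totalOrder = record { isTotalOrder = isTotalOrder }

  open TotalOrder totalOrder using (antisym; poset)
    renaming (refl to ⊑-refl; reflexive to ⊑-reflexive; trans to ⊑-trans)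
  open PartialOrderReasoning poset

  -- Ordered field arithmetic.

  +-mono : ∀ {x y u v} → x ⊑ y → u ⊑ v → x + u ⊑ y + v
  +-mono {x} {y} {u} {v} x≤y u≤v = begin
    x + u  ≤⟨ +-mono-≤ u x≤y ⟩
    y + u  ≈⟨ +-comm y u ⟩
    u + y  ≤⟨ +-mono-≤ y u≤v ⟩
    v + y  ≈⟨ +-comm v y ⟩
    y + v  ∎

  x≤x+y : ∀ x {y} → 0# ⊑ y → x ⊑ x + y
  x≤x+y x {y} 0≤y = begin
    x       ≈⟨ +-identityʳ x ⟨
    x + 0#  ≤⟨ +-mono ⊑-refl 0≤y ⟩
    x + y   ∎

  x≤y⇒x-y≤0 : ∀ {x y} → x ⊑ y → x - y ⊑ 0#
  x≤y⇒x-y≤0 {x} {y} x≤y = begin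
    x - y  ≤⟨ +-mono-≤ (- y) x≤y ⟩
    y - y  ≈⟨ -‿inverseʳ y ⟩
    0#     ∎

  x≤y⇒0≤y-x : ∀ {x y} → x ⊑ y → 0# ⊑ y - x
  x≤y⇒0≤y-x {x} {y} x≤y = begin
    0#     ≈⟨ -‿inverseʳ x ⟨
    x - x  ≤⟨ +-mono-≤ (- x) x≤y ⟩
    y - x  ∎

  x+[z-x]≈z : ∀ x z → x + (z - x) ≈ z
  x+[z-x]≈z x z = trans (sym (+-assoc x z (- x))) (xyx⁻¹≈y x z)

  y≤z-x⇒x+y≤z : ∀ {x y z} → y ⊑ z - x → x + y ⊑ z
  y≤z-x⇒x+y≤z {x} {y} {z} y≤z-x = begin
    x + y        ≤⟨ +-mono ⊑-refl y≤z-x ⟩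
    x + (z - x)  ≈⟨ x+[z-x]≈z x z ⟩
    z            ∎

  x+y≤z⇒y≤z-x : ∀ {x y z} → x + y ⊑ z → y ⊑ z - x
  x+y≤z⇒y≤z-x {x} {y} {z} x+y≤z = begin
    y          ≈⟨ xyx⁻¹≈y x y ⟨
    x + y - x  ≤⟨ +-mono-≤ (- x) x+y≤z ⟩
    z - x      ∎

  -‿antimonoʳ : ∀ z {x y} → y ⊑ x → z - x ⊑ z - y
  -‿antimonoʳ z {x} {y} y≤x = x+y≤z⇒y≤z-x (begin
    y + (z - x)  ≤⟨ +-mono-≤ (z - x) y≤x ⟩
    x + (z - x)  ≈⟨ x+[z-x]≈z x z ⟩
    z            ∎)

  telescope : ∀ x y z → (x - y) + (y - z) ≈ x - z
  telescope x y z = begin-equality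
    (x - y) + (y - z)    ≈⟨ +-assoc (x - y) y (- z) ⟨
    ((x - y) + y) - z    ≈⟨ +-congʳ (+-assoc x (- y) y) ⟩
    (x + (- y + y)) - z  ≈⟨ +-congʳ (+-congˡ (-‿inverseˡ y)) ⟩
    (x + 0#) - z         ≈⟨ +-congʳ (+-identityʳ x) ⟩
    x - z                ∎

  *-monoˡ : ∀ {w x y} → 0# ⊑ w → x ⊑ y → w * x ⊑ w * y
  *-monoˡ {w} {x} {y} 0≤w x≤y = begin
    w * x                ≤⟨ x≤x+y (w * x) (*-nonNeg 0≤w (x≤y⇒0≤y-x x≤y)) ⟩
    w * x + w * (y - x)  ≈⟨ distribˡ w x (y - x) ⟨
    w * (x + (y - x))    ≈⟨ *-congˡ (x+[z-x]≈z x y) ⟩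
    w * y                ∎

  -- Inequalities between finite sums.

  sum-mono : {f g : Vector Carrier n} → (∀ i → f i ⊑ g i) → sum f ⊑ sum g
  sum-mono {zero}  _   = ⊑-refl
  sum-mono {suc n} f≤g = +-mono (f≤g zero) (sum-mono (f≤g ∘ suc))

  sum≥0 : {f : Vector Carrier n} → (∀ i → 0# ⊑ f i) → 0# ⊑ sum f
  sum≥0 {zero}  _   = ⊑-refl
  sum≥0 {suc n} {f} f≥0 = begin
    0#                        ≤⟨ f≥0 zero ⟩
    f zero                    ≤⟨ x≤x+y (f zero) (sum≥0 (f≥0 ∘ suc)) ⟩
    f zero + sum (f ∘ suc)    ∎

  term≤sum : (f : Vector Carrier n) → (∀ i → 0# ⊑ f i) → ∀ i → f i ⊑ sum f
  term≤sum {suc n} f f≥0 i = begin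
    f i                          ≤⟨ x≤x+y (f i) (sum≥0 (f≥0 ∘ punchIn i)) ⟩
    f i + sum (f ∘ punchIn i)    ≈⟨ sum-remove f ⟨
    sum f                        ∎

  -- `punchIn i j` runs over the indices other than `i`. Applied to two distinct colours at one
  -- vertex, this shows that a colour of value 1 leaves nothing for any other.
  twoTerms≤sum : (f : Vector Carrier (suc n)) → (∀ i → 0# ⊑ f i) →
                 ∀ i j → f i + f (punchIn i j) ⊑ sum f
  twoTerms≤sum f f≥0 i j = begin
    f i + f (punchIn i j)
      ≤⟨ +-mono ⊑-refl (term≤sum (f ∘ punchIn i) (f≥0 ∘ punchIn i) j) ⟩
    f i + sum (f ∘ punchIn i)
      ≈⟨ sum-remove f ⟨
    sum f ∎

  -- Sums of selected steps of a decreasing sequence.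

  Antitone : Vector Carrier n → Set ℓ₂
  Antitone a = ∀ p q → p Fin.≤ q → a q ⊑ a p

  -- Index `p` stands for the step from entry `p` to the next one, so there is one step fewer than
  -- entries. With `a` the sorted values and `b` the boundary test for a fixed vertex, this is T_v.
  selectedSteps : Vector Carrier (suc m) → (Fin m → Bool) → Carrier
  selectedSteps a b = sum λ p → if b p then a (inject₁ p) - a (suc p) else 0#

  antitone-tail : {a : Vector Carrier (suc n)} → Antitone a → Antitone (a ∘ suc)
  antitone-tail anti p q p≤q = anti (suc p) (suc q) (s≤s p≤q)

  antitone-head : {a : Vector Carrier (suc (suc n))} → Antitone a →
                  a (suc zero) ⊑ a zero
  antitone-head anti = anti zero (suc zero) z≤n

  selectedSteps≥0 : {a : Vector Carrier (suc m)} → Antitone a →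
                    ∀ b → 0# ⊑ selectedSteps a b
  selectedSteps≥0 {a = a} anti b = sum≥0 step≥0
    where
    step≥0 : ∀ p → 0# ⊑ (if b p then a (inject₁ p) - a (suc p) else 0#)
    step≥0 p with b p
    ... | false = ⊑-refl
    ... | true  = x≤y⇒0≤y-x (anti (inject₁ p) (suc p)
                    (ℕ.≤-trans (ℕ.≤-reflexive (toℕ-inject₁ p)) (ℕ.n≤1+n _)))

  tail≤selectedSteps : {a : Vector Carrier (suc (suc m))} → Antitone a →
    ∀ b → selectedSteps (a ∘ suc) (b ∘ suc) ⊑ selectedSteps a b
  tail≤selectedSteps {a = a} anti b with b zero
  ... | false = ⊑-reflexive (sym (+-identityˡ _))
  ... | true  = begin
    T                          ≤⟨ x≤x+y T (x≤y⇒0≤y-x (antitone-head anti)) ⟩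
    T + (a zero - a (suc zero))  ≈⟨ +-comm T _ ⟩
    (a zero - a (suc zero)) + T  ∎
    where T = selectedSteps (a ∘ suc) (b ∘ suc)

  -- The steps between `q` and `r` are all selected and telescope to `a q - a r`; any other selected
  -- step only adds a non-negative amount. The induction first discards the steps before `q`, then
  -- peels off those up to `r`.
  selectedSteps-lower : {a : Vector Carrier (suc m)} → Antitone a → ∀ b q r →
    (∀ p → q Fin.≤ inject₁ p → suc p Fin.≤ r → b p ≡ true) →
    q Fin.≤ r → a q - a r ⊑ selectedSteps a b
  selectedSteps-lower anti b zero zero _ _ =
    ⊑-trans (⊑-reflexive (-‿inverseʳ _)) (selectedSteps≥0 anti b)
  selectedSteps-lower {suc m} {a} anti b zero (suc r) selected _
    rewrite selected zero z≤n (s≤s z≤n) = begin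
    a zero - a (suc r)
      ≈⟨ telescope (a zero) (a (suc zero)) (a (suc r)) ⟨
    (a zero - a (suc zero)) + (a (suc zero) - a (suc r))
      ≤⟨ +-mono ⊑-refl
           (selectedSteps-lower (antitone-tail anti) (b ∘ suc) zero r
             (λ p _ p<r → selected (suc p) z≤n (s≤s p<r)) z≤n) ⟩
    (a zero - a (suc zero)) + selectedSteps (a ∘ suc) (b ∘ suc) ∎
  selectedSteps-lower {suc m} {a} anti b (suc q) (suc r) selected (s≤s q≤r) =
    ⊑-trans
      (selectedSteps-lower (antitone-tail anti) (b ∘ suc) q r
        (λ p q≤p p<r → selected (suc p) (s≤s q≤p) (s≤s p<r)) q≤r)
      (tail≤selectedSteps anti b)

  -- No step before `q` is selected, so the sum is at most the full descent from `q` to the end of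
  -- the last selected step, which `bound` keeps below `z`; if nothing is selected, `0# ⊑ z`
  -- suffices. The induction avoids searching for that last step by adjusting `z` instead.
  selectedSteps-upper : {a : Vector Carrier (suc m)} → Antitone a → ∀ b q z →
    0# ⊑ z →
    (∀ p → b p ≡ true → q Fin.≤ inject₁ p × a q - a (suc p) ⊑ z) →
    selectedSteps a b ⊑ z
  selectedSteps-upper {zero} _ _ _ _ 0≤z _ = 0≤z
  selectedSteps-upper {suc m} {a} anti b zero z 0≤z bound with b zero in b₀
  -- Measuring the descent from the second entry, which is no larger than the first, keeps every
  -- bound by `z` valid.
  ... | false = begin
    0# + T  ≈⟨ +-identityˡ T ⟩
    T       ≤⟨ selectedSteps-upper (antitone-tail anti) (b ∘ suc) zero z 0≤z
                 (λ p bp → z≤n ,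
                   ⊑-trans (+-mono-≤ _ (antitone-head anti)) (proj₂ (bound (suc p) bp))) ⟩
    z       ∎
    where T = selectedSteps (a ∘ suc) (b ∘ suc)
  -- The first step itself is at most z, so z may be lowered by it.
  ... | true = y≤z-x⇒x+y≤z
    (selectedSteps-upper (antitone-tail anti) (b ∘ suc) zero _
      (x≤y⇒0≤y-x (proj₂ (bound zero b₀)))
      (λ p bp → z≤n , x+y≤z⇒y≤z-x
        (⊑-trans (⊑-reflexive (telescope _ _ _)) (proj₂ (bound (suc p) bp)))))
  selectedSteps-upper {suc m} {a} anti b (suc q) z 0≤z bound with b zero in b₀
  -- A selected step at position zero would lie before `q`.
  ... | true  = contradiction (proj₁ (bound zero b₀)) λ ()
  ... | false = begin
    0# + T  ≈⟨ +-identityˡ T ⟩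
    T       ≤⟨ selectedSteps-upper (antitone-tail anti) (b ∘ suc) q z 0≤z
                 (λ p bp → ℕ.≤-pred (proj₁ (bound (suc p) bp)) , proj₂ (bound (suc p) bp)) ⟩
    z       ∎
    where T = selectedSteps (a ∘ suc) (b ∘ suc)

  -- Moves the boundary test from the weight to the step, so that the double sum can be regrouped by
  -- vertex.
  *-if-comm : ∀ b x y → x * (if b then y else 0#) ≈ y * (if b then x else 0#)
  *-if-comm true  x y = *-comm x y
  *-if-comm false x y = trans (zeroʳ x) (sym (zeroʳ y))

  -- The Lovász extension as a weighted sum over vertices.

  module _ (I : MUHV K (suc m) k) where
    open MUHV I

    module _ (y : Vector Carrier (suc m)) (o : DecreasingOrder K y) where
      open DecreasingOrder o

      position : Fin (suc m) → Fin (suc m)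
      position = π ⟨$⟩ˡ_

      value-at-position : ∀ v → y (π ⟨$⟩ʳ position v) ≡ y v
      value-at-position v = ≡.cong y (inverseʳ π)

      onBoundary : Fin (suc m) → Fin m → Bool
      onBoundary v p = lookup (∂ (prefix K π (inject₁ p))) v

      -- For the indicator vector of a colour class this is 1 if `v` belongs to the class and has a
      -- neighbour outside it, and 0 otherwise.
      unhappiness : Vector Carrier (suc m)
      unhappiness v = selectedSteps (λ p → y (π ⟨$⟩ʳ p)) (onBoundary v)

      unhappiness≥0 : ∀ v → 0# ⊑ unhappiness v
      unhappiness≥0 v = selectedSteps≥0 decreasing (onBoundary v)

      ∈-prefix⁺ : ∀ {p v} → position v Fin.≤ p → v ∈ prefix K π p
      ∈-prefix⁺ {p} = ∈-tabulate⁺ (λ v → position v Fin.≤? p)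

      ∈-prefix⁻ : ∀ {p v} → v ∈ prefix K π p → position v Fin.≤ p
      ∈-prefix⁻ {p} = ∈-tabulate⁻ (λ v → position v Fin.≤? p)

      -- If `v` is placed before `u`, each prefix that reaches `v` but not `u` has `v` on its
      -- boundary, so all steps between the two are selected. If `u` comes first, the difference is
      -- at most zero.
      difference≤unhappiness : ∀ v u → Adj v u → y v - y u ⊑ unhappiness v
      difference≤unhappiness v u adj with position v Fin.≤? position u
      ... | no v≰u = begin
        y v - y u      ≤⟨ x≤y⇒x-y≤0 yv≤yu ⟩
        0#             ≤⟨ unhappiness≥0 v ⟩
        unhappiness v  ∎
        where
        yv≤yu : y v ⊑ y u
        yv≤yu = ≡.subst₂ _⊑_ (value-at-position v) (value-at-position u)
          (decreasing (position u) (position v) (ℕ.≰⇒≥ v≰u))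
      ... | yes v≤u = begin
        y v - y u
          ≡⟨ ≡.cong₂ _-_ (value-at-position v) (value-at-position u) ⟨
        y (π ⟨$⟩ʳ position v) - y (π ⟨$⟩ʳ position u)
          ≤⟨ selectedSteps-lower decreasing (onBoundary v) _ _ selected v≤u ⟩
        unhappiness v ∎
        where
        selected : ∀ p → position v Fin.≤ inject₁ p → suc p Fin.≤ position u →
                   onBoundary v p ≡ true
        selected p v≤p p<u = []=⇒lookup (∈∂⁺ graph (∈-prefix⁺ v≤p) adj λ u∈ →
          ℕ.<⇒≱ p<u (≡.subst (_ ≤_) (toℕ-inject₁ p) (∈-prefix⁻ u∈)))

      -- When `v` is on the boundary of the prefix ending at `p`, some neighbour `u` is missing from
      -- it and sits at `suc p` or later. The descent from `v` to `suc p` is then at most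
      -- `y v - y u`, hence at most `z`.
      unhappiness-least : ∀ v z → 0# ⊑ z → (∀ u → Adj v u → y v - y u ⊑ z) →
                          unhappiness v ⊑ z
      unhappiness-least v z 0≤z bound =
        selectedSteps-upper decreasing (onBoundary v) (position v) z 0≤z bound′
        where
        bound′ : ∀ p → onBoundary v p ≡ true →
                 position v Fin.≤ inject₁ p ×
                 y (π ⟨$⟩ʳ position v) - y (π ⟨$⟩ʳ suc p) ⊑ z
        bound′ p v∈∂ with ∈∂⁻ graph (lookup⇒[]= v _ v∈∂)
        ... | v∈ , u , adj , u∉ = ∈-prefix⁻ v∈ , (begin
          y (π ⟨$⟩ʳ position v) - y (π ⟨$⟩ʳ suc p)
            ≤⟨ -‿antimonoʳ _ (decreasing (suc p) (position u) p<u) ⟩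
          y (π ⟨$⟩ʳ position v) - y (π ⟨$⟩ʳ position u)
            ≡⟨ ≡.cong₂ _-_ (value-at-position v) (value-at-position u) ⟩
          y v - y u
            ≤⟨ bound u adj ⟩
          z ∎)
          where
          p<u : suc p Fin.≤ position u
          p<u = ≡.subst (λ t → suc t ≤ toℕ (position u)) (toℕ-inject₁ p)
            (ℕ.≰⇒> (u∉ ∘ ∈-prefix⁺))

      lovász≈sum-unhappiness :
        lovász K (boundaryWeight K I) y o ≈ sum λ v → weight v * unhappiness v
      lovász≈sum-unhappiness = begin-equality
        -- With `suc m` vertices, `lovászSum` and `boundaryWeight` unfold to this double sum.
        sum (λ p → step p * sum (λ v → if onBoundary v p then weight v else 0#))
          ≈⟨ sum-cong-≋ (λ p → *-distribˡ-sum (step p)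
               (λ v → if onBoundary v p then weight v else 0#)) ⟩
        sum (λ p → sum λ v → step p * (if onBoundary v p then weight v else 0#))
          ≈⟨ sum-cong-≋ (λ p → sum-cong-≋ λ v →
               *-if-comm (onBoundary v p) (step p) (weight v)) ⟩
        sum (λ p → sum λ v → weight v * (if onBoundary v p then step p else 0#))
          ≈⟨ ∑-comm (λ p v → weight v * (if onBoundary v p then step p else 0#)) ⟩
        sum (λ v → sum λ p → weight v * (if onBoundary v p then step p else 0#))
          ≈⟨ sum-cong-≋ (λ v → *-distribˡ-sum (weight v)
               (λ p → if onBoundary v p then step p else 0#)) ⟨
        sum (λ v → weight v * unhappiness v) ∎
        where
        step : Fin m → Carrier
        step p = y (π ⟨$⟩ʳ inject₁ p) - y (π ⟨$⟩ʳ suc p)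

    -- Comparison of the two programs.

    module _ (y : Assignment K (suc m) k) where

      LP⇒CP : ∀ {xc x} → LP-Feasible K I y xc x → CP-Feasible K I y
      -- The constraints on `y` alone carry the same field names in both programs.
      LP⇒CP lp = record { LP-Feasible lp }

      module _ (o : ∀ i → DecreasingOrder K (λ v → y v i)) where

        -- The entries do not depend on `o` up to `≈`: for every order they are least among the
        -- non-negative bounds on the differences to the neighbours.
        optimal : Assignment K (suc m) k
        optimal v i = unhappiness (λ v → y v i) (o i) v

        optimal-feasible : CP-Feasible K I y →
                           LP-Feasible K I y optimal (λ v → sum (optimal v))
        optimal-feasible cp = record
          { CP-Feasible cp
          ; difference = λ v u adj i → difference≤unhappiness _ (o i) v u adj
          ; total      = λ _ → refl
          ; xc≥0       = λ v i → unhappiness≥0 _ (o i) v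
          ; x≥0        = λ v → sum≥0 λ i → unhappiness≥0 _ (o i) v
          }

        optimal-objective :
          LP-objective K I (λ v → sum (optimal v)) ≈ CP-objective K I y o
        optimal-objective = begin-equality
          sum (λ v → weight v * sum (optimal v))
            ≈⟨ sum-cong-≋ (λ v → *-distribˡ-sum (weight v) (optimal v)) ⟩
          sum (λ v → sum λ i → weight v * optimal v i)
            ≈⟨ ∑-comm (λ v i → weight v * optimal v i) ⟩
          sum (λ i → sum λ v → weight v * optimal v i)
            ≈⟨ sum-cong-≋ (λ i → lovász≈sum-unhappiness (λ v → y v i) (o i)) ⟨
          CP-objective K I y o ∎

        -- Each `xc v i` is a non-negative bound on the differences in colour `i`, hence a
        -- competitor in `unhappiness-least`.
        optimal≤ : ∀ {xc x} → LP-Feasible K I y xc x → ∀ v → sum (optimal v) ⊑ x v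
        optimal≤ {xc} {x} lp v = begin
          sum (optimal v)
            ≤⟨ sum-mono (λ i → unhappiness-least _ (o i) v (xc v i) (xc≥0 v i)
                 (λ u adj → difference v u adj i)) ⟩
          sum (xc v)
            ≈⟨ total v ⟨
          x v ∎
          where open LP-Feasible lp

        -- Since the weights are non-negative, minimality at each vertex passes to the weighted sum.
        optimal-isMinimum : CP-Feasible K I y →
          IsMinimum K (λ xs → LP-Feasible K I y (proj₁ xs) (proj₂ xs))
                      (λ xs → LP-objective K I (proj₂ xs))
                      (CP-objective K I y o)
        optimal-isMinimum cp =
          (_ , optimal-feasible cp , optimal-objective) , λ xs lp → begin
            CP-objective K I y o
              ≈⟨ optimal-objective ⟨
            sum (λ v → weight v * sum (optimal v))
              ≤⟨ sum-mono (λ v → *-monoˡ (weight≥0 v) (optimal≤ lp v)) ⟩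
            LP-objective K I (proj₂ xs) ∎

  -- Every colour i occurs, which gives the value 1, and so does some colour
  -- other than i, which gives the value 0.
  decreasingOrder : 2 ≤ k → (I : MUHV K n k) (y : Assignment K n k) →
    CP-Feasible K I y → ∀ i → DecreasingOrder K (λ v → y v i)
  decreasingOrder (s≤s (s≤s _)) I y cp i
    with sortingPermutation totalOrder (λ v → y v i)
  ... | π , decreasing = record
    { π          = π
    ; decreasing = decreasing
    ; first≈1    = first≈1
    ; last≈0     = last≈0
    }
    where
    open MUHV I
    open CP-Feasible cp

    first≈1 : ∀ p → toℕ p ≡ 0 → y (π ⟨$⟩ʳ p) i ≈ 1#
    first≈1 p p≡0 with allUsed i
    ... | v , v-coloured = antisym
      (⊑-trans (term≤sum (y _) (y≥0 _) i) (⊑-reflexive (sum≈1 _)))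
      (begin
        1#                           ≈⟨ precolour v i v-coloured ⟨
        y v i                        ≡⟨ ≡.cong (λ u → y u i) (inverseʳ π) ⟨
        y (π ⟨$⟩ʳ (π ⟨$⟩ˡ v)) i
          ≤⟨ decreasing p (π ⟨$⟩ˡ v) (ℕ.≤-trans (ℕ.≤-reflexive p≡0) z≤n) ⟩
        y (π ⟨$⟩ʳ p) i               ∎)

    last≈0 : ∀ p → suc (toℕ p) ≡ _ → y (π ⟨$⟩ʳ p) i ≈ 0#
    -- `punchIn i zero` is a colour other than `i`; it exists because matching on `2 ≤ k` has
    -- exposed two successors in `k`.
    last≈0 p 1+p≡n with allUsed (punchIn i zero)
    ... | v , v-coloured = antisym
      (begin
        y (π ⟨$⟩ʳ p) i
          ≤⟨ decreasing (π ⟨$⟩ˡ v) p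
               (ℕ.≤-pred (ℕ.≤-trans (toℕ<n (π ⟨$⟩ˡ v))
                                    (ℕ.≤-reflexive (≡.sym 1+p≡n)))) ⟩
        y (π ⟨$⟩ʳ (π ⟨$⟩ˡ v)) i      ≡⟨ ≡.cong (λ u → y u i) (inverseʳ π) ⟩
        y v i                        ≤⟨ x+y≤z⇒y≤z-x 1+yvi≤1 ⟩
        1# - 1#                      ≈⟨ -‿inverseʳ 1# ⟩
        0#                           ∎)
      (y≥0 _ i)
      where
      1+yvi≤1 : 1# + y v i ⊑ 1#
      1+yvi≤1 = begin
        1# + y v i                     ≈⟨ +-congʳ (precolour v _ v-coloured) ⟨
        y v (punchIn i zero) + y v i   ≈⟨ +-comm _ _ ⟩
        y v i + y v (punchIn i zero)   ≤⟨ twoTerms≤sum (y v) (y≥0 v) i zero ⟩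
        sum (y v)                      ≈⟨ sum≈1 v ⟩
        1#                             ∎

theorem10 : ∀ {c ℓ₁ ℓ₂} (K : OrderedField c ℓ₁ ℓ₂) (n k : ℕ) → 2 ≤ k →
    (I : MUHV K n k) →
    (∀ (y : Assignment K n k) →
    (∃₂ λ xc x → LP-Feasible K I y xc x) ⇔ CP-Feasible K I y)
    ×
    (∀ (y : Assignment K n k) → CP-Feasible K I y →
    (∀ i → DecreasingOrder K (λ v → y v i))
    ×
    (∀ (o : ∀ i → DecreasingOrder K (λ v → y v i)) →
    IsMinimum K
    (λ xs → LP-Feasible K I y (proj₁ xs) (proj₂ xs))
    (λ xs → LP-objective K I (proj₂ xs))
    (CP-objective K I y o)))
-- Without vertices no colour could be used, yet `2≤k` guarantees a colour.
theorem10 K zero (suc k) 2≤k I with MUHV.allUsed I zero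
... | () , _
theorem10 K (suc m) k 2≤k I =
  (λ y → mk⇔
    (λ (_ , _ , lp) → LP⇒CP K I y lp)
    (λ cp → let o = decreasingOrder K 2≤k I y cp in
      optimal K I y o , _ , optimal-feasible K I y o cp)) ,
  (λ y cp →
    decreasingOrder K 2≤k I y cp ,
    λ o → optimal-isMinimum K I y o cp)
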